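{- For all $k\geq2$, the $3$-restricted edge-connectivity of the DCell $D_{k,2}$ satisfies $\lambda_3(D_{k,2})=3n+3k-7$ with $n=2$, i.e. $\lambda_3(D_{k,2})=3k-1$.
   Context: DCell $D_{k,n}$ ($n\geq 2$, $k\geq 0$) is defined recursively. $D_{0,n}$ is the complete graph $K_n$ on vertices $0,1,\dots,n-1$. Let $t_{k,n}=|V(D_{k,n})|$. For $k\geq1$, $D_{k,n}$ is built from $t_{k-1,n}+1$ disjoint copies $D^0_{k-1,n},\dots,D^{t_{k-1,n}}_{k-1,n}$ of $D_{k-1,n}$; a vertex of copy $D^i_{k-1,n}$ is labeled $(i,a_{k-1},\dots,a_0)$, where $(a_{k-1},\dots,a_0)$ is its label in $D_{k-1,n}$, and its index within the copy is $uid_{k-1}=a_0+\sum_{l=1}^{k-1}a_l t_{l-1,n}$. For each pair $a<b$ of copy indices, one edge joins the vertex of $D^a_{k-1,n}$ with $uid_{k-1}=b-1$ to the vertex of $D^b_{k-1,n}$ with $uid_{k-1}=a$. An edge set $F$ is a $3$-restricted edge-cut of $G$ if $G-F$ is disconnected and every component of $G-F$ has at least $3$ vertices; $\lambda_3(G)$ is the minimum size of such a cut. -}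

module Defs where

open import Data.Nat using (ℕ; zero; suc; _+_; _*_; _∸_; _<_; _≤_)
open import Data.Fin using (Fin; toℕ)
open import Data.Product using (_×_; _,_; Σ; ∃; ∃-syntax)
open import Data.Sum using (_⊎_)
open import Data.List using (List; length)
open import Data.List.Membership.Propositional using (_∈_)
open import Data.List.Relation.Unary.All using (All)
open import Data.List.Relation.Unary.AllPairs using (AllPairs)
open import Relation.Binary.Construct.Closure.ReflexiveTransitive using (Star)
open import Relation.Binary.PropositionalEquality using (_≡_; _≢_)
open import Relation.Nullary using (¬_)

-- t k n = |V(D_{k,n})| :  t_0 = n,  t_k = t_{k-1} (t_{k-1} + 1)
t : ℕ → ℕ → ℕ
t zero    n = n
t (suc k) n = t k n * suc (t k n)

-- vertex labels (a_k, ..., a_0) of D_{k,n}: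
-- a vertex of D_{k,n} is (copy index i ∈ {0..t_{k-1}}, label in D_{k-1,n})
Vertex : ℕ → ℕ → Set
Vertex zero    n = Fin n
Vertex (suc k) n = Fin (suc (t k n)) × Vertex k n

uid : (k n : ℕ) → Vertex k n → ℕ
uid zero    n a       = toℕ a
uid (suc k) n (i , x) = toℕ i * t k n + uid k n x

Cross : (k n : ℕ) → Vertex (suc k) n → Vertex (suc k) n → Set
Cross k n (a , x) (b , y) =
  toℕ a < toℕ b × uid k n x ≡ toℕ b ∸ 1 × uid k n y ≡ toℕ a

Adj : (k n : ℕ) → Vertex k n → Vertex k n → Set
Adj zero    n a b = a ≢ b
Adj (suc k) n (i , x) (j , y) =
  (i ≡ j × Adj k n x y) ⊎ Cross k n (i , x) (j , y) ⊎ Cross k n (j , y) (i , x)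

SameEdge : {V : Set} → V × V → V × V → Set
SameEdge (a , b) (c , d) = (a ≡ c × b ≡ d) ⊎ (a ≡ d × b ≡ c)

-- an edge set F: a list of edges of G, no undirected edge listed twice;
-- its size is  length F
IsEdgeSet : {V : Set} → (V → V → Set) → List (V × V) → Set
IsEdgeSet {V} E F =
  All (λ e → E (Data.Product.proj₁ e) (Data.Product.proj₂ e)) F
  × AllPairs (λ e f → ¬ SameEdge e f) F

AdjMinus : {V : Set} → (V → V → Set) → List (V × V) → V → V → Set
AdjMinus E F x y = E x y × ¬ ((x , y) ∈ F ⊎ (y , x) ∈ F)

Reach : {V : Set} → (V → V → Set) → List (V × V) → V → V → Set
Reach E F = Star (AdjMinus E F)

Is3RestrictedCut : {V : Set} → (V → V → Set) → List (V × V) → Set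
Is3RestrictedCut {V} E F =
  IsEdgeSet E F
  × (∃[ x ] ∃[ y ] ¬ Reach E F x y)
  × ((x : V) → ∃[ y ] ∃[ z ]
        (x ≢ y × x ≢ z × y ≢ z × Reach E F x y × Reach E F x z))

Lambda3≡ : {V : Set} → (V → V → Set) → ℕ → Set
Lambda3≡ {V} E m =
  (∃[ F ] (Is3RestrictedCut E F × length F ≡ m))
  × ((F : List (V × V)) → Is3RestrictedCut E F → m ≤ length F)

{-# OPTIONS --safe #-}
module Submission where

-- The upper bound is the boundary of a path on three vertices in one of the 6-cycles D₁. Cutting
-- every 6-cycle into two such paths shows that all components left have at least three vertices.
--
-- For the lower bound, let S be the vertex set of a component after the cut. The claim that
-- j ≤ |S|, |V ∖ S| with j ≤ 3 forces |∂S| ≥ j (k + 1) − 2 (j − 1) is proved by induction on k.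
-- If S fills one copy of the smaller DCell and misses another, then |∂S| is at least the size T of a
-- copy. Otherwise, up to complementing S, no copy is filled; then every copy met by S has inner
-- boundary at least k, and a copy with s vertices in S sends s cross edges to distinct other
-- copies, so that all but as many as S meets of these copies yield boundary edges.

open import Defs
open import Data.Bool using (Bool; true; false; not; _∧_; if_then_else_)
open import Data.Fin using (Fin; zero; suc; toℕ; cast; combine; remQuot; punchIn; punchOut; _↑ˡ_; _↑ʳ_)
open import Data.Fin.Patterns using (0F; 1F; 2F)
open import Data.Fin.Permutation using (permutation)
import Data.Fin.Properties as Fin
open import Data.List using (List; []; _∷_; map; length; _++_; tabulate)
open import Data.List.Properties using (length-map; length-++)
open import Data.List.Membership.Propositional using (_∈_)
open import Data.List.Membership.Propositional.Properties
  using (∈-map⁺; ∈-map⁻; ∈-++⁺ˡ; ∈-++⁺ʳ; ∈-++⁻; ∈-tabulate⁺; ∈-tabulate⁻)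
import Data.List.Membership.DecPropositional as DecMembership
open import Data.List.Relation.Unary.All as All using (All; []; _∷_)
import Data.List.Relation.Unary.All.Properties as All
open import Data.List.Relation.Unary.AllPairs as AllPairs using (AllPairs; []; _∷_)
import Data.List.Relation.Unary.AllPairs.Properties as AllPairs
open import Data.List.Relation.Unary.Any using (here; there)
open import Data.Nat using (ℕ; zero; suc; _+_; _*_; _∸_; _<_; _≤_; _≤?_; _<?_; _≟_; _⊓_; z≤n; s≤s; z<s)
open import Data.Nat.Properties
open import Data.Nat.Tactic.RingSolver using (solve-∀)
open import Data.Product using (_×_; _,_; proj₁; proj₂; map₂; uncurry; ∃-syntax)
open import Data.Product.Properties using (≡-dec)
open import Data.Sum as Sum using (_⊎_; inj₁; inj₂)
open import Effect.Monad using (RawMonad)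
open import Function using (_∘_)
open import Relation.Binary.Construct.Closure.ReflexiveTransitive using (ε; _◅_; _◅◅_; reverse; gmap)
open import Relation.Binary.Definitions using (DecidableEquality; tri<; tri≈; tri>)
open import Relation.Binary.PropositionalEquality
  using (_≡_; _≢_; refl; sym; trans; cong; cong₂; subst; module ≡-Reasoning)
open import Relation.Nullary
  using (¬_; Dec; yes; no; does; contradiction; ¬?; _×-dec_; _⊎-dec_; _→-dec_)
open import Relation.Nullary.Decidable
  using (decidable-stable; dec-true; dec-false; ¬¬-excluded-middle; from-yes; True; toWitness)
open import Relation.Nullary.Negation using (¬¬-Monad)
open import Algebra.Properties.CommutativeMonoid.Sum +-0-commutativeMonoid
  using (sum; sum-cong-≗; sum-remove; ∑-distrib-+; sum-permute; sum-replicate-zero)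
open import Algebra.Properties.Semiring.Sum +-*-semiring using (*-distribˡ-sum)

-- Finite sums of natural numbers

sum-mono : ∀ {n} {f g : Fin n → ℕ} → (∀ i → f i ≤ g i) → sum f ≤ sum g
sum-mono {zero}  f≤g = z≤n
sum-mono {suc n} f≤g = +-mono-≤ (f≤g zero) (sum-mono (f≤g ∘ suc))

sum-zero : ∀ {n} {f : Fin n → ℕ} → (∀ i → f i ≡ 0) → sum f ≡ 0
sum-zero {n} f≡0 = trans (sum-cong-≗ f≡0) (sum-replicate-zero n)

term≤sum : ∀ {n} (f : Fin n → ℕ) i → f i ≤ sum f
term≤sum f zero    = m≤m+n (f zero) _
term≤sum f (suc i) = ≤-trans (term≤sum (f ∘ suc) i) (m≤n+m _ (f zero))

sum-supported : ∀ {n} (f : Fin n → ℕ) i → (∀ j → j ≢ i → f j ≡ 0) → sum f ≡ f i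
sum-supported {suc n} f i f≡0 = begin
  sum f                          ≡⟨ sum-remove {i = i} f ⟩
  f i + sum (f ∘ punchIn i)      ≡⟨ cong (f i +_) (sum-zero λ j → f≡0 _ (Fin.punchInᵢ≢i i j)) ⟩
  f i + 0                        ≡⟨ +-identityʳ (f i) ⟩
  f i                            ∎
  where open ≡-Reasoning

sum≤n : ∀ {n} {f : Fin n → ℕ} → (∀ i → f i ≤ 1) → sum f ≤ n
sum≤n {zero}  f≤1 = z≤n
sum≤n {suc n} f≤1 = +-mono-≤ (f≤1 zero) (sum≤n (f≤1 ∘ suc))

sum<n : ∀ {n} {f : Fin n → ℕ} w → (∀ i → f i ≤ 1) → f w ≡ 0 → sum f < n
sum<n {suc n} {f} w f≤1 fw≡0 = s≤s (begin
  sum f                      ≡⟨ sum-remove {i = w} f ⟩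
  f w + sum (f ∘ punchIn w)  ≡⟨ cong (_+ sum (f ∘ punchIn w)) fw≡0 ⟩
  sum (f ∘ punchIn w)        ≤⟨ sum≤n (f≤1 ∘ punchIn w) ⟩
  n                          ∎)
  where open ≤-Reasoning

sum-↑ : ∀ m n (f : Fin (m + n) → ℕ) → sum f ≡ sum (λ i → f (i ↑ˡ n)) + sum (λ j → f (m ↑ʳ j))
sum-↑ zero    n f = refl
sum-↑ (suc m) n f = trans (cong (f zero +_) (sum-↑ m n (f ∘ suc))) (sym (+-assoc (f zero) _ _))

sum-combine : ∀ m n (f : Fin (m * n) → ℕ) → sum f ≡ sum (λ i → sum (λ j → f (combine {m} {n} i j)))
sum-combine zero    n f = refl
sum-combine (suc m) n f =
  trans (sum-↑ n (m * n) f) (cong (sum (λ j → f (j ↑ˡ (m * n))) +_) (sum-combine m n (λ w → f (n ↑ʳ w))))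

sum-cast : ∀ {m n} (eq : m ≡ n) (f : Fin n → ℕ) → sum f ≡ sum (f ∘ cast eq)
sum-cast refl f = sum-cong-≗ λ i → sym (cong f (Fin.cast-is-id refl i))

-- The cast exchanges the factors: `t (suc k) n` puts the copy size before the number of copies,
-- whereas `combine` has them the other way round.
pair : ∀ m n → Fin m → Fin n → Fin (n * m)
pair m n i j = cast (*-comm m n) (combine i j)

unpair : ∀ m n → Fin (n * m) → Fin m × Fin n
unpair m n w = remQuot {m} n (cast (*-comm n m) w)

unpair-pair : ∀ m n i j → unpair m n (pair m n i j) ≡ (i , j)
unpair-pair m n i j = trans
  (cong (remQuot {m} n) (Fin.cast-involutive (*-comm n m) (*-comm m n) (combine i j)))
  (Fin.remQuot-combine i j)

pair-unpair : ∀ m n w → uncurry (pair m n) (unpair m n w) ≡ w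
pair-unpair m n w = trans
  (cong (cast (*-comm m n)) (Fin.combine-remQuot {m} n (cast (*-comm n m) w)))
  (Fin.cast-involutive (*-comm m n) (*-comm n m) w)

toℕ-pair : ∀ m n i j → toℕ (pair m n i j) ≡ toℕ i * n + toℕ j
toℕ-pair m n i j = trans (Fin.toℕ-cast (*-comm m n) (combine i j))
  (trans (Fin.toℕ-combine i j) (cong (_+ toℕ j) (*-comm n (toℕ i))))

sum-pair : ∀ m n (f : Fin (n * m) → ℕ) → sum f ≡ sum (λ i → sum (λ j → f (pair m n i j)))
sum-pair m n f = trans (sum-cast (*-comm m n) f) (sum-combine m n (f ∘ cast (*-comm m n)))

-- Vertices as elements of Fin (t k n)

rank : ∀ k n → Vertex k n → Fin (t k n)
rank zero    n a       = a
rank (suc k) n (i , x) = pair (suc (t k n)) (t k n) i (rank k n x)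

unrank : ∀ k n → Fin (t k n) → Vertex k n
unrank zero    n a = a
unrank (suc k) n w = map₂ (unrank k n) (unpair (suc (t k n)) (t k n) w)

unrank-rank : ∀ k n x → unrank k n (rank k n x) ≡ x
unrank-rank zero    n a       = refl
unrank-rank (suc k) n (i , x) = trans
  (cong (map₂ (unrank k n)) (unpair-pair (suc (t k n)) (t k n) i (rank k n x)))
  (cong (i ,_) (unrank-rank k n x))

rank-unrank : ∀ k n w → rank k n (unrank k n w) ≡ w
rank-unrank zero    n a = refl
rank-unrank (suc k) n w = trans
  (cong (pair (suc (t k n)) (t k n) (proj₁ iu)) (rank-unrank k n (proj₂ iu)))
  (pair-unpair (suc (t k n)) (t k n) w)
  where iu = unpair (suc (t k n)) (t k n) w

uid≡toℕ-rank : ∀ k n x → uid k n x ≡ toℕ (rank k n x)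
uid≡toℕ-rank zero    n a       = refl
uid≡toℕ-rank (suc k) n (i , x) = trans
  (cong (toℕ i * t k n +_) (uid≡toℕ-rank k n x))
  (sym (toℕ-pair (suc (t k n)) (t k n) i (rank k n x)))

uid-unrank : ∀ k n w → uid k n (unrank k n w) ≡ toℕ w
uid-unrank k n w = trans (uid≡toℕ-rank k n _) (cong toℕ (rank-unrank k n w))

uid-injective : ∀ k n {x y} → uid k n x ≡ uid k n y → x ≡ y
uid-injective k n {x} {y} eq = begin
  x                        ≡⟨ unrank-rank k n x ⟨
  unrank k n (rank k n x)  ≡⟨ cong (unrank k n) (Fin.toℕ-injective (trans (sym (uid≡toℕ-rank k n x)) (trans eq (uid≡toℕ-rank k n y)))) ⟩
  unrank k n (rank k n y)  ≡⟨ unrank-rank k n y ⟩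
  y                        ∎
  where open ≡-Reasoning

_≟ⱽ_ : ∀ {k n} → DecidableEquality (Vertex k n)
_≟ⱽ_ {zero}  = Fin._≟_
_≟ⱽ_ {suc k} = ≡-dec Fin._≟_ (_≟ⱽ_ {k})

-- Sums over vertices

∑ⱽ : ∀ k n → (Vertex k n → ℕ) → ℕ
∑ⱽ zero    n f = sum f
∑ⱽ (suc k) n f = sum λ i → ∑ⱽ k n λ x → f (i , x)

∑ⱽ-rank : ∀ k n (f : Fin (t k n) → ℕ) → ∑ⱽ k n (f ∘ rank k n) ≡ sum f
∑ⱽ-rank zero    n f = refl
∑ⱽ-rank (suc k) n f = trans
  (sum-cong-≗ λ i → ∑ⱽ-rank k n λ u → f (pair (suc (t k n)) (t k n) i u))
  (sym (sum-pair (suc (t k n)) (t k n) f))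

∑ⱽ-cong : ∀ k n {f g : Vertex k n → ℕ} → (∀ v → f v ≡ g v) → ∑ⱽ k n f ≡ ∑ⱽ k n g
∑ⱽ-cong zero    n f≡g = sum-cong-≗ f≡g
∑ⱽ-cong (suc k) n f≡g = sum-cong-≗ λ i → ∑ⱽ-cong k n λ x → f≡g (i , x)

∑ⱽ-mono : ∀ k n {f g : Vertex k n → ℕ} → (∀ v → f v ≤ g v) → ∑ⱽ k n f ≤ ∑ⱽ k n g
∑ⱽ-mono zero    n f≤g = sum-mono f≤g
∑ⱽ-mono (suc k) n f≤g = sum-mono λ i → ∑ⱽ-mono k n λ x → f≤g (i , x)

∑ⱽ-+ : ∀ k n (f g : Vertex k n → ℕ) → ∑ⱽ k n (λ v → f v + g v) ≡ ∑ⱽ k n f + ∑ⱽ k n g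
∑ⱽ-+ zero    n f g = ∑-distrib-+ f g
∑ⱽ-+ (suc k) n f g = trans
  (sum-cong-≗ λ i → ∑ⱽ-+ k n (λ x → f (i , x)) (λ x → g (i , x)))
  (∑-distrib-+ (λ i → ∑ⱽ k n λ x → f (i , x)) (λ i → ∑ⱽ k n λ x → g (i , x)))

∑ⱽ-unrank : ∀ k n (f : Vertex k n → ℕ) → ∑ⱽ k n f ≡ sum (f ∘ unrank k n)
∑ⱽ-unrank k n f = trans (∑ⱽ-cong k n λ v → cong f (sym (unrank-rank k n v))) (∑ⱽ-rank k n (f ∘ unrank k n))

∑ⱽ-zero : ∀ k n {f : Vertex k n → ℕ} → (∀ v → f v ≡ 0) → ∑ⱽ k n f ≡ 0
∑ⱽ-zero k n f≡0 = trans (∑ⱽ-unrank k n _) (sum-zero λ w → f≡0 (unrank k n w))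

∑ⱽ-one : ∀ k n → ∑ⱽ k n (λ _ → 1) ≡ t k n
∑ⱽ-one k n = trans (∑ⱽ-unrank k n _) (sum-one (t k n))
  where
  sum-one : ∀ m → sum {m} (λ _ → 1) ≡ m
  sum-one zero    = refl
  sum-one (suc m) = cong suc (sum-one m)

term≤∑ⱽ : ∀ k n (f : Vertex k n → ℕ) v → f v ≤ ∑ⱽ k n f
term≤∑ⱽ zero    n f v       = term≤sum f v
term≤∑ⱽ (suc k) n f (i , x) =
  ≤-trans (term≤∑ⱽ k n (λ y → f (i , y)) x) (term≤sum (λ j → ∑ⱽ k n λ y → f (j , y)) i)

∑ⱽ-involution : ∀ k n (π : Vertex k n → Vertex k n) → (∀ v → π (π v) ≡ v) →
                ∀ f → ∑ⱽ k n (f ∘ π) ≡ ∑ⱽ k n f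
∑ⱽ-involution k n π ππ f = begin
  ∑ⱽ k n (f ∘ π)                         ≡⟨ ∑ⱽ-unrank k n (f ∘ π) ⟩
  sum (f ∘ π ∘ unrank k n)               ≡⟨ sum-cong-≗ (λ w → cong f (unrank-rank k n (π (unrank k n w)))) ⟨
  sum (f ∘ unrank k n ∘ π′)              ≡⟨ sum-permute (f ∘ unrank k n) (permutation π′ π′ π′π′ π′π′) ⟨
  sum (f ∘ unrank k n)                   ≡⟨ ∑ⱽ-unrank k n f ⟨
  ∑ⱽ k n f                               ∎
  where
  open ≡-Reasoning
  π′ : Fin (t k n) → Fin (t k n)
  π′ = rank k n ∘ π ∘ unrank k n
  π′π′ : ∀ w → π′ (π′ w) ≡ w
  π′π′ w = begin
    rank k n (π (unrank k n (rank k n (π (unrank k n w)))))  ≡⟨ cong (rank k n ∘ π) (unrank-rank k n _) ⟩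
    rank k n (π (π (unrank k n w)))                          ≡⟨ cong (rank k n) (ππ _) ⟩
    rank k n (unrank k n w)                                  ≡⟨ rank-unrank k n w ⟩
    w                                                        ∎

⟦_⟧ : ∀ {P : Set} → Dec P → ℕ
⟦ yes _ ⟧ = 1
⟦ no  _ ⟧ = 0

⟦⟧-yes : ∀ {P : Set} (P? : Dec P) → P → ⟦ P? ⟧ ≡ 1
⟦⟧-yes (yes _) p = refl
⟦⟧-yes (no ¬p) p = contradiction p ¬p

⟦⟧-no : ∀ {P : Set} (P? : Dec P) → ¬ P → ⟦ P? ⟧ ≡ 0
⟦⟧-no (yes p) ¬p = contradiction p ¬p
⟦⟧-no (no _)  ¬p = refl

⟦⟧-mono : ∀ {P Q : Set} (P? : Dec P) (Q? : Dec Q) → (P → Q) → ⟦ P? ⟧ ≤ ⟦ Q? ⟧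
⟦⟧-mono (yes p) Q? f = ≤-reflexive (sym (⟦⟧-yes Q? (f p)))
⟦⟧-mono (no _)  Q? f = z≤n

∑ⱽ-⟦≟⟧≤1 : ∀ k n a → ∑ⱽ k n (λ v → ⟦ v ≟ⱽ a ⟧) ≤ 1
∑ⱽ-⟦≟⟧≤1 zero n a = begin
  sum (λ v → ⟦ v Fin.≟ a ⟧)  ≡⟨ sum-supported _ a (λ j → ⟦⟧-no (j Fin.≟ a)) ⟩
  ⟦ a Fin.≟ a ⟧              ≡⟨ ⟦⟧-yes (a Fin.≟ a) refl ⟩
  1                          ∎
  where open ≤-Reasoning
∑ⱽ-⟦≟⟧≤1 (suc k) n (i , a) = begin
  sum (λ j → ∑ⱽ k n λ x → ⟦ (j , x) ≟ⱽ (i , a) ⟧)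
    ≡⟨ sum-supported _ i (λ j j≢i → ∑ⱽ-zero k n λ x → ⟦⟧-no ((j , x) ≟ⱽ (i , a)) (j≢i ∘ cong proj₁)) ⟩
  ∑ⱽ k n (λ x → ⟦ (i , x) ≟ⱽ (i , a) ⟧)
    ≤⟨ ∑ⱽ-mono k n (λ x → ⟦⟧-mono ((i , x) ≟ⱽ (i , a)) (x ≟ⱽ a) (cong proj₂)) ⟩
  ∑ⱽ k n (λ x → ⟦ x ≟ⱽ a ⟧)
    ≤⟨ ∑ⱽ-⟦≟⟧≤1 k n a ⟩
  1 ∎
  where open ≤-Reasoning

-- The perfect matching formed by the cross edges

-- Skipping i shifts the indices above i down by one and keeps those below. These are the uids
-- `b ∸ 1` and `a` that `Cross` prescribes, so `punchOut` describes both ends of a cross edge.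
toℕ-punchOut-< : ∀ {n} {i j : Fin (suc n)} (i≢j : i ≢ j) → toℕ i < toℕ j → toℕ (punchOut i≢j) ≡ toℕ j ∸ 1
toℕ-punchOut-< {_}     {zero}  {suc j}       _   _         = refl
toℕ-punchOut-< {suc n} {suc i} {suc (suc j)} i≢j (s≤s i<j) = cong suc (toℕ-punchOut-< (i≢j ∘ cong suc) i<j)
toℕ-punchOut-< {suc n} {suc i} {suc zero}    _   (s≤s ())

toℕ-punchOut-> : ∀ {n} {i j : Fin (suc n)} (i≢j : i ≢ j) → toℕ j < toℕ i → toℕ (punchOut i≢j) ≡ toℕ j
toℕ-punchOut-> {suc n} {suc i} {zero}  _   _         = refl
toℕ-punchOut-> {suc n} {suc i} {suc j} i≢j (s≤s j<i) = cong suc (toℕ-punchOut-> (i≢j ∘ cong suc) j<i)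

-- The edge between copies i and j ends at the vertex of copy i whose uid is punchOut of j at i.
σ : ∀ k n → Vertex (suc k) n → Vertex (suc k) n
σ k n (i , x) = punchIn i (rank k n x) , unrank k n (punchOut (Fin.punchInᵢ≢i i (rank k n x)))

σ-port : ∀ k n {i j} (i≢j : i ≢ j) (j≢i : j ≢ i) →
         σ k n (i , unrank k n (punchOut i≢j)) ≡ (j , unrank k n (punchOut j≢i))
σ-port k n {i} {j} i≢j j≢i = helper _ (trans (cong (punchIn i) (rank-unrank k n _)) (Fin.punchIn-punchOut i≢j))
  where
  -- The index `l` is left free so that it can be unified with j; the value of `punchOut` is the
  -- same for every proof of the inequality.
  helper : ∀ {l} (l≢i : l ≢ i) → l ≡ j →
           (l , unrank k n (punchOut l≢i)) ≡ (j , unrank k n (punchOut j≢i))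
  helper {l} l≢i refl = cong (λ u → l , unrank k n u) (Fin.punchOut-cong l refl)

-- The image of `(i , x)` is the end in copy j of the edge between copies i and j, so `σ-port` leads
-- back to the end in copy i. That end is x because `punchOut` undoes `punchIn`.
σ-involutive : ∀ k n v → σ k n (σ k n v) ≡ v
σ-involutive k n (i , x) = begin
  σ k n (j , unrank k n (punchOut j≢i))      ≡⟨ σ-port k n j≢i (j≢i ∘ sym) ⟩
  (i , unrank k n (punchOut (j≢i ∘ sym)))    ≡⟨ cong (λ u → i , unrank k n u) (Fin.punchOut-punchIn i) ⟩
  (i , unrank k n (rank k n x))              ≡⟨ cong (i ,_) (unrank-rank k n x) ⟩
  (i , x)                                    ∎
  where
  open ≡-Reasoning
  j = punchIn i (rank k n x)
  j≢i = Fin.punchInᵢ≢i i (rank k n x)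

Adj-σ : ∀ k n v → Adj (suc k) n v (σ k n v)
Adj-σ k n (i , x) with Fin.<-cmp i (punchIn i (rank k n x))
... | tri< i<j _ _ = inj₂ (inj₁ (i<j , uid-x , trans (uid-unrank k n _) (toℕ-punchOut-> j≢i i<j)))
  where
  j≢i = Fin.punchInᵢ≢i i (rank k n x)
  uid-x = trans (uid≡toℕ-rank k n x)
         (trans (cong toℕ (sym (Fin.punchOut-punchIn i))) (toℕ-punchOut-< (j≢i ∘ sym) i<j))
... | tri≈ _ i≡j _ = contradiction (sym i≡j) (Fin.punchInᵢ≢i i (rank k n x))
... | tri> _ _ j<i = inj₂ (inj₂ (j<i , trans (uid-unrank k n _) (toℕ-punchOut-< j≢i j<i) , uid-x))
  where
  j≢i = Fin.punchInᵢ≢i i (rank k n x)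
  uid-x = trans (uid≡toℕ-rank k n x)
         (trans (cong toℕ (sym (Fin.punchOut-punchIn i))) (toℕ-punchOut-> (j≢i ∘ sym) j<i))

+-interchange : ∀ a b c d → (a + b) + (c + d) ≡ (a + c) + (b + d)
+-interchange = solve-∀

-- Sums over directed edges: every edge contributes in both directions.
∑ᴱ : ∀ k → (Vertex k 2 → Vertex k 2 → ℕ) → ℕ
∑ᴱ zero    h = h 0F 1F + h 1F 0F
∑ᴱ (suc k) h = sum (λ i → ∑ᴱ k λ x y → h (i , x) (i , y)) + ∑ⱽ (suc k) 2 (λ v → h v (σ k 2 v))

-- Only adjacent pairs are summed, so the comparison may assume adjacency. `boundary≤length` relies
-- on this: only edges are known to be covered by the cut.
∑ᴱ-mono : ∀ k {h h′} → (∀ u v → Adj k 2 u v → h u v ≤ h′ u v) → ∑ᴱ k h ≤ ∑ᴱ k h′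
∑ᴱ-mono zero    h≤h′ = +-mono-≤ (h≤h′ 0F 1F λ ()) (h≤h′ 1F 0F λ ())
∑ᴱ-mono (suc k) h≤h′ = +-mono-≤
  (sum-mono λ i → ∑ᴱ-mono k λ x y xy → h≤h′ (i , x) (i , y) (inj₁ (refl , xy)))
  (∑ⱽ-mono (suc k) 2 λ v → h≤h′ v (σ k 2 v) (Adj-σ k 2 v))

∑ᴱ-zero : ∀ k → ∑ᴱ k (λ _ _ → 0) ≡ 0
∑ᴱ-zero zero    = refl
∑ᴱ-zero (suc k) = cong₂ _+_ (sum-zero {suc (t k 2)} λ _ → ∑ᴱ-zero k) (∑ⱽ-zero (suc k) 2 λ _ → refl)

∑ᴱ-+ : ∀ k h h′ → ∑ᴱ k (λ u v → h u v + h′ u v) ≡ ∑ᴱ k h + ∑ᴱ k h′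
∑ᴱ-+ zero    h h′ = +-interchange (h 0F 1F) (h′ 0F 1F) (h 1F 0F) (h′ 1F 0F)
∑ᴱ-+ (suc k) h h′ = trans
  (cong₂ _+_
    (trans (sum-cong-≗ λ i → ∑ᴱ-+ k (λ x y → h (i , x) (i , y)) (λ x y → h′ (i , x) (i , y)))
           (∑-distrib-+ (λ i → ∑ᴱ k λ x y → h (i , x) (i , y)) (λ i → ∑ᴱ k λ x y → h′ (i , x) (i , y))))
    (∑ⱽ-+ (suc k) 2 (λ v → h v (σ k 2 v)) (λ v → h′ v (σ k 2 v))))
  (+-interchange (sum λ i → ∑ᴱ k λ x y → h (i , x) (i , y)) _ _ _)

-- Reindexing by the involution σ reverses the cross edges.
∑ᴱ-flip : ∀ k h → ∑ᴱ k (λ u v → h v u) ≡ ∑ᴱ k h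
∑ᴱ-flip zero    h = +-comm (h 1F 0F) (h 0F 1F)
∑ᴱ-flip (suc k) h = cong₂ _+_ (sum-cong-≗ λ i → ∑ᴱ-flip k λ x y → h (i , x) (i , y)) (begin
  ∑ⱽ (suc k) 2 (λ v → h (σ k 2 v) v)
    ≡⟨ ∑ⱽ-cong (suc k) 2 (λ v → cong (h (σ k 2 v)) (sym (σ-involutive k 2 v))) ⟩
  ∑ⱽ (suc k) 2 (λ v → h (σ k 2 v) (σ k 2 (σ k 2 v)))
    ≡⟨ ∑ⱽ-involution (suc k) 2 (σ k 2) (σ-involutive k 2) (λ v → h v (σ k 2 v)) ⟩
  ∑ⱽ (suc k) 2 (λ v → h v (σ k 2 v)) ∎)
  where open ≡-Reasoning

isPair? : ∀ {k n} (a b u v : Vertex k n) → Dec (u ≡ a × v ≡ b)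
isPair? a b u v = (u ≟ⱽ a) ×-dec (v ≟ⱽ b)

-- No directed edge is enumerated twice: a pair within one copy can occur only in the sum of that
-- copy, a pair between copies only as the cross edge of its first endpoint.
∑ᴱ-isPair≤1 : ∀ k a b → ∑ᴱ k (λ u v → ⟦ isPair? a b u v ⟧) ≤ 1
∑ᴱ-isPair≤1 zero 0F 0F = z≤n
∑ᴱ-isPair≤1 zero 0F 1F = s≤s z≤n
∑ᴱ-isPair≤1 zero 1F 0F = s≤s z≤n
∑ᴱ-isPair≤1 zero 1F 1F = z≤n
∑ᴱ-isPair≤1 (suc k) (i , a) (j , b) with i Fin.≟ j
... | yes refl = begin
  sum inner + ∑ⱽ (suc k) 2 cross       ≡⟨ cong₂ _+_ (sum-supported inner i inner-zero) (∑ⱽ-zero (suc k) 2 cross-zero) ⟩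
  inner i + 0                          ≡⟨ +-identityʳ (inner i) ⟩
  inner i                              ≤⟨ ∑ᴱ-mono k (λ x y _ → ⟦⟧-mono (isPair? (i , a) (i , b) (i , x) (i , y)) (isPair? a b x y)
                                           λ where (refl , refl) → refl , refl) ⟩
  ∑ᴱ k (λ x y → ⟦ isPair? a b x y ⟧)   ≤⟨ ∑ᴱ-isPair≤1 k a b ⟩
  1                                    ∎
  where
  open ≤-Reasoning
  inner = λ l → ∑ᴱ k λ x y → ⟦ isPair? (i , a) (i , b) (l , x) (l , y) ⟧
  cross = λ v → ⟦ isPair? (i , a) (i , b) v (σ k 2 v) ⟧
  inner-zero : ∀ l → l ≢ i → inner l ≡ 0
  inner-zero l l≢i = n≤0⇒n≡0 (≤-trans
    (∑ᴱ-mono k λ x y _ → ≤-reflexive (⟦⟧-no (isPair? (i , a) (i , b) (l , x) (l , y)) (l≢i ∘ cong proj₁ ∘ proj₁)))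
    (≤-reflexive (∑ᴱ-zero k)))
  cross-zero : ∀ v → cross v ≡ 0
  cross-zero v@(l , x) = ⟦⟧-no (isPair? (i , a) (i , b) v (σ k 2 v)) λ where
    (refl , σv≡) → Fin.punchInᵢ≢i l (rank k 2 x) (cong proj₁ σv≡)
... | no i≢j = begin
  sum inner + ∑ⱽ (suc k) 2 cross           ≡⟨ cong (_+ ∑ⱽ (suc k) 2 cross) (sum-zero inner-zero) ⟩
  ∑ⱽ (suc k) 2 cross                       ≤⟨ ∑ⱽ-mono (suc k) 2 (λ v → ⟦⟧-mono (isPair? (i , a) (j , b) v (σ k 2 v)) (v ≟ⱽ (i , a)) proj₁) ⟩
  ∑ⱽ (suc k) 2 (λ v → ⟦ v ≟ⱽ (i , a) ⟧)    ≤⟨ ∑ⱽ-⟦≟⟧≤1 (suc k) 2 (i , a) ⟩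
  1                                        ∎
  where
  open ≤-Reasoning
  inner = λ l → ∑ᴱ k λ x y → ⟦ isPair? (i , a) (j , b) (l , x) (l , y) ⟧
  cross = λ v → ⟦ isPair? (i , a) (j , b) v (σ k 2 v) ⟧
  inner-zero : ∀ l → inner l ≡ 0
  inner-zero l = n≤0⇒n≡0 (≤-trans
    (∑ᴱ-mono k λ x y _ → ≤-reflexive (⟦⟧-no (isPair? (i , a) (j , b) (l , x) (l , y))
      λ (p , q) → i≢j (trans (sym (cong proj₁ p)) (cong proj₁ q))))
    (≤-reflexive (∑ᴱ-zero k)))

-- The isoperimetric inequality

-- Copy i of the smaller DCell meets the set in s i and its complement in b i vertices; c i boundary
-- edges lie inside the copy, and x i vertices of the set in it have their cross edge leaving the set.
module Copies
  {T d : ℕ} (T-large : 3 * d + 2 ≤ T)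
  (s b c x : Fin (suc T) → ℕ)
  (s+b : ∀ i → s i + b i ≡ T)
  (out : ∀ f → s f ≤ x f + sum (λ u → 1 ⊓ s (punchIn f u)))
  (c-large : ∀ i r → 1 ≤ r → r ≤ 3 → r ≤ s i → r ≤ b i → r * d + 2 ≤ c i + r)
  where

  open ≤-Reasoning

  -- The case r = 1 of `c-large`.
  c-mixed : ∀ i → 1 ≤ s i → 1 ≤ b i → suc d ≤ c i
  c-mixed i 1≤s 1≤b = +-cancelʳ-≤ 1 (suc d) (c i) (begin
    suc d + 1   ≡⟨ rearrange d ⟩
    1 * d + 2   ≤⟨ c-large i 1 ≤-refl (s≤s z≤n) 1≤s 1≤b ⟩
    c i + 1     ∎)
    where
    rearrange : ∀ d → suc d + 1 ≡ 1 * d + 2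
    rearrange = solve-∀

  -- Every copy j other than the full copy f and the empty copy e gives a route f – j – e which the
  -- boundary has to meet; all these routes and the edge f – e are edge-disjoint.
  module _ {f e} (full : b f ≡ 0) (empty : s e ≡ 0) where

    full-size : ∀ {i} → b i ≡ 0 → s i ≡ T
    full-size {i} bi≡0 = trans (sym (+-identityʳ (s i))) (trans (cong (s i +_) (sym bi≡0)) (s+b i))

    -- A mixed copy has inner boundary. A full copy has T cross edges to the T other copies; since
    -- copy e is empty, they cannot all stay in the set.
    nonempty≤boundary : ∀ i → 1 ⊓ s i ≤ c i + x i
    nonempty≤boundary i with s i ≟ 0 | b i ≟ 0
    ... | yes si≡0 | _        = ≤-trans (≤-trans (m⊓n≤n 1 (s i)) (≤-reflexive si≡0)) z≤n
    ... | no  si≢0 | no  bi≢0 = ≤-trans (m⊓n≤m 1 (s i)) (≤-trans (s≤s z≤n)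
      (≤-trans (c-mixed i (n≢0⇒n>0 si≢0) (n≢0⇒n>0 bi≢0)) (m≤m+n (c i) (x i))))
    ... | no  si≢0 | yes bi≡0 = ≤-trans (m⊓n≤m 1 (s i)) (≤-trans 1≤x (m≤n+m (x i) (c i)))
      where
      i≢e : i ≢ e
      i≢e i≡e = si≢0 (trans (cong s i≡e) empty)
      others<T : sum (λ u → 1 ⊓ s (punchIn i u)) < T
      others<T = sum<n (punchOut i≢e) (λ u → m⊓n≤m 1 (s (punchIn i u)))
        (cong (1 ⊓_) (trans (cong s (Fin.punchIn-punchOut i≢e)) empty))
      1≤x : 1 ≤ x i
      1≤x = +-cancelʳ-≤ (sum (λ u → 1 ⊓ s (punchIn i u))) 1 (x i)
        (≤-trans others<T (≤-trans (≤-reflexive (sym (full-size bi≡0))) (out i)))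

    -- Each of the T cross edges of copy f either leaves the set or is charged to the nonempty copy
    -- where it ends, which pays by `nonempty≤boundary`.
    T≤boundary : T ≤ sum c + sum x
    T≤boundary = begin
      T                                                       ≡⟨ full-size full ⟨
      s f                                                     ≤⟨ out f ⟩
      x f + sum (λ u → 1 ⊓ s (punchIn f u))                   ≤⟨ +-mono-≤ (m≤n+m (x f) (c f)) (sum-mono λ u → nonempty≤boundary (punchIn f u)) ⟩
      (c f + x f) + sum (λ u → c (punchIn f u) + x (punchIn f u)) ≡⟨ sum-remove {i = f} (λ i → c i + x i) ⟨
      sum (λ i → c i + x i)                                   ≡⟨ ∑-distrib-+ c x ⟩
      sum c + sum x                                           ∎

  module _ (no-full : ∀ i → 1 ≤ b i) where

    -- As `1 ⊓ s i` indicates whether copy i meets the set, this counts the nonempty copies besides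
    -- f.
    others : Fin (suc T) → ℕ
    others f = sum λ u → 1 ⊓ s (punchIn f u)

    c-nonempty : ∀ i → suc d * (1 ⊓ s i) ≤ c i
    c-nonempty i with s i ≟ 0
    ... | yes si≡0 = ≤-trans (≤-reflexive (trans (cong (λ m → suc d * (1 ⊓ m)) si≡0) (*-zeroʳ (suc d)))) z≤n
    ... | no  si≢0 = ≤-trans (*-monoʳ-≤ (suc d) (m⊓n≤m 1 (s i)))
      (≤-trans (≤-reflexive (*-identityʳ (suc d))) (c-mixed i (n≢0⇒n>0 si≢0) (no-full i)))

    -- Each other nonempty copy has at least d + 1 inner boundary edges. One of them makes up for a
    -- cross edge of copy f that may end there inside the set; the other d remain, and all `s f`
    -- cross edges count in full.
    boundary≥centre+others : ∀ f → (c f + s f) + d * others f ≤ sum c + sum x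
    boundary≥centre+others f = begin
      (c f + s f) + d * others f                ≤⟨ +-monoˡ-≤ (d * others f) (+-monoʳ-≤ (c f) (out f)) ⟩
      (c f + (x f + others f)) + d * others f   ≡⟨ rearrange (c f) (x f) (others f) d ⟩
      (c f + suc d * others f) + x f            ≡⟨ cong (λ m → (c f + m) + x f) (*-distribˡ-sum (suc d) (λ u → 1 ⊓ s (punchIn f u))) ⟩
      (c f + sum (λ u → suc d * (1 ⊓ s (punchIn f u)))) + x f
                                                ≤⟨ +-mono-≤ (+-monoʳ-≤ (c f) (sum-mono λ u → c-nonempty (punchIn f u))) (term≤sum x f) ⟩
      (c f + sum (c ∘ punchIn f)) + sum x       ≡⟨ cong (_+ sum x) (sum-remove {i = f} c) ⟨
      sum c + sum x                             ∎
      where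
      rearrange : ∀ a b m d → (a + (b + m)) + d * m ≡ (a + suc d * m) + b
      rearrange = solve-∀

    -- If fewer than r vertices of the copy are missing, `c-large` does not apply to r. But then at
    -- most two are missing, and `T-large` makes `s f` at least 3 d.
    centre-boundary : ∀ f r → 1 ≤ r → r ≤ 3 → r ≤ s f → r * d + 2 ≤ c f + s f
    centre-boundary f r 1≤r r≤3 r≤s with r ≤? b f
    ... | yes r≤b = ≤-trans (c-large f r 1≤r r≤3 r≤s r≤b) (+-monoʳ-≤ (c f) r≤s)
    ... | no  r≰b = nearly-full d T-large (c-mixed f (≤-trans 1≤r r≤s) (no-full f))
      where
      nearly-full : ∀ d → 3 * d + 2 ≤ T → suc d ≤ c f → r * d + 2 ≤ c f + s f
      -- For d = 0 the inner boundary is only known to have one edge, so the summand 2 takes its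
      -- other unit from `s f`. For positive d the inner boundary supplies both.
      nearly-full zero    _  1≤c = begin
        r * 0 + 2   ≡⟨ cong (_+ 2) (*-zeroʳ r) ⟩
        1 + 1       ≤⟨ +-mono-≤ 1≤c (≤-trans 1≤r r≤s) ⟩
        c f + s f   ∎
      nearly-full (suc d) T≥ d+2≤c = begin
        r * suc d + 2   ≤⟨ +-mono-≤ (≤-trans (*-monoˡ-≤ (suc d) r≤3) 3d≤s) (≤-trans (s≤s (s≤s z≤n)) d+2≤c) ⟩
        s f + c f       ≡⟨ +-comm (s f) (c f) ⟩
        c f + s f       ∎
        where
        b≤2 : b f ≤ 2
        b≤2 = ≤-pred (≤-trans (≰⇒> r≰b) r≤3)
        3d≤s : 3 * suc d ≤ s f
        3d≤s = +-cancelʳ-≤ 2 (3 * suc d) (s f) (≤-trans T≥ (≤-trans (≤-reflexive (sym (s+b f))) (+-monoʳ-≤ (s f) b≤2)))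

    -- Copy f pays r d + 2 for r of its vertices, and every further nonempty copy pays d.
    boundary≥ : ∀ j f r → 1 ≤ r → r ≤ 3 → r ≤ s f → j ≤ r + others f → j * d + 2 ≤ sum c + sum x
    boundary≥ j f r 1≤r r≤3 r≤s j≤ = begin
      j * d + 2                      ≤⟨ +-monoˡ-≤ 2 (*-monoˡ-≤ d j≤) ⟩
      (r + others f) * d + 2         ≡⟨ rearrange r (others f) d ⟩
      (r * d + 2) + d * others f     ≤⟨ +-monoˡ-≤ (d * others f) (centre-boundary f r 1≤r r≤3 r≤s) ⟩
      (c f + s f) + d * others f     ≤⟨ boundary≥centre+others f ⟩
      sum c + sum x                  ∎
      where
      rearrange : ∀ r m d → (r + m) * d + 2 ≡ (r * d + 2) + d * m
      rearrange = solve-∀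

    size≤ : ∀ r f → (∀ i → s i ≤ r) → sum s ≤ r + r * others f
    size≤ r f s≤r = begin
      sum s                                       ≡⟨ sum-remove {i = f} s ⟩
      s f + sum (s ∘ punchIn f)                   ≤⟨ +-mono-≤ (s≤r f) (sum-mono λ u → s≤r*[1⊓s] (punchIn f u)) ⟩
      r + sum (λ u → r * (1 ⊓ s (punchIn f u)))   ≡⟨ cong (r +_) (*-distribˡ-sum r (λ u → 1 ⊓ s (punchIn f u))) ⟨
      r + r * others f                            ∎
      where
      s≤r*[1⊓s] : ∀ i → s i ≤ r * (1 ⊓ s i)
      s≤r*[1⊓s] i with s i | s≤r i
      ... | zero  | _   = z≤n
      ... | suc _ | s≤r = ≤-trans s≤r (≤-reflexive (sym (*-identityʳ r)))

    -- Let r be the largest of 3, 2, 1 such that some copy f holds r vertices of the set. For r < 3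
    -- no copy holds more than r, so `size≤` forces enough other nonempty copies to reach j.
    boundary-no-full : ∀ j → 1 ≤ j → j ≤ 3 → j ≤ sum s → j * d + 2 ≤ sum c + sum x
    boundary-no-full j 1≤j j≤3 j≤s with Fin.any? (λ i → 3 ≤? s i)
    ... | yes (f , 3≤s) = boundary≥ j f 3 (s≤s z≤n) ≤-refl 3≤s (≤-trans j≤3 (m≤m+n 3 (others f)))
    ... | no ¬3≤s with Fin.any? (λ i → 2 ≤? s i)
    ...   | yes (f , 2≤s) = boundary≥ j f 2 (s≤s z≤n) (s≤s (s≤s z≤n)) 2≤s
              (two (others f) (≤-trans j≤s (size≤ 2 f λ i → ≤-pred (≰⇒> λ 3≤s → ¬3≤s (i , 3≤s)))))
      where
      two : ∀ m → j ≤ 2 + 2 * m → j ≤ 2 + m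
      two zero    j≤ = j≤
      two (suc m) _  = ≤-trans j≤3 (s≤s (s≤s (s≤s z≤n)))
    ...   | no ¬2≤s with Fin.any? (λ i → 1 ≤? s i)
    ...     | yes (f , 1≤s) = boundary≥ j f 1 ≤-refl (s≤s z≤n) 1≤s (≤-trans j≤s
                (≤-trans (size≤ 1 f λ i → ≤-pred (≰⇒> λ 2≤s → ¬2≤s (i , 2≤s))) (≤-reflexive (cong suc (*-identityˡ (others f))))))
    ...     | no ¬1≤s = contradiction
                (≤-trans 1≤j (≤-trans j≤s (≤-reflexive (sum-zero λ i → n≤0⇒n≡0 (≤-pred (≰⇒> λ 1≤s → ¬1≤s (i , 1≤s)))))))
                λ ()

-- Sizes and boundaries of vertex sets

#_ : Bool → ℕ
# true  = 1
# false = 0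

size : ∀ k → (Vertex k 2 → Bool) → ℕ
size k S = ∑ⱽ k 2 λ v → # S v

-- Of the two directions of an edge only the one leaving S contributes, so every boundary edge
-- counts once.
boundary : ∀ k → (Vertex k 2 → Bool) → ℕ
boundary k S = ∑ᴱ k λ u v → # (S u ∧ not (S v))

size+size-not : ∀ k S → size k S + size k (not ∘ S) ≡ t k 2
size+size-not k S = begin
  size k S + size k (not ∘ S)            ≡⟨ ∑ⱽ-+ k 2 (λ v → # S v) (λ v → # not (S v)) ⟨
  ∑ⱽ k 2 (λ v → # S v + # not (S v))     ≡⟨ ∑ⱽ-cong k 2 (λ v → complement (S v)) ⟩
  ∑ⱽ k 2 (λ _ → 1)                       ≡⟨ ∑ⱽ-one k 2 ⟩
  t k 2                                  ∎
  where
  open ≡-Reasoning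
  complement : ∀ p → # p + # not p ≡ 1
  complement true  = refl
  complement false = refl

boundary-not : ∀ k S → boundary k (not ∘ S) ≤ boundary k S
boundary-not k S = begin
  ∑ᴱ k (λ u v → # (not (S u) ∧ not (not (S v))))  ≤⟨ ∑ᴱ-mono k (λ u v _ → swapped (S u) (S v)) ⟩
  ∑ᴱ k (λ u v → # (S v ∧ not (S u)))              ≡⟨ ∑ᴱ-flip k (λ u v → # (S u ∧ not (S v))) ⟩
  ∑ᴱ k (λ u v → # (S u ∧ not (S v)))              ∎
  where
  open ≤-Reasoning
  swapped : ∀ p q → # (not p ∧ not (not q)) ≤ # (q ∧ not p)
  swapped true  _     = z≤n
  swapped false true  = ≤-refl
  swapped false false = z≤n

size-not-not : ∀ k S → size k S ≤ size k (not ∘ not ∘ S)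
size-not-not k S = ∑ⱽ-mono k 2 λ v → double (S v)
  where
  double : ∀ p → # p ≤ # not (not p)
  double true  = ≤-refl
  double false = ≤-refl

-- T is the boundary obtained from a full and an empty copy, and 3 k + 2 is what the induction step
-- requires for j = 3. The induction only needs that the factor T + 1 is at least 3.
t-large : ∀ k → 3 * k + 2 ≤ t k 2
t-large zero    = ≤-refl
t-large (suc k) = begin
  3 * suc k + 2            ≤⟨ m≤m+n (3 * suc k + 2) (6 * k + 1) ⟩
  3 * suc k + 2 + (6 * k + 1) ≡⟨ rearrange k ⟩
  (3 * k + 2) * 3          ≤⟨ *-mono-≤ (t-large k) (s≤s (≤-trans (m≤n+m 2 (3 * k)) (t-large k))) ⟩
  t k 2 * suc (t k 2)      ∎
  where
  open ≤-Reasoning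
  rearrange : ∀ k → 3 * suc k + 2 + (6 * k + 1) ≡ (3 * k + 2) * 3
  rearrange = solve-∀

-- A cross edge of copy f that starts in S either leaves S or shows that the copy where it ends
-- meets S.
out-count : ∀ k (S : Vertex (suc k) 2 → Bool) f →
  size k (λ x → S (f , x)) ≤
  ∑ⱽ k 2 (λ x → # (S (f , x) ∧ not (S (σ k 2 (f , x)))))
    + sum (λ u → 1 ⊓ size k (λ y → S (punchIn f u , y)))
out-count k S f = begin
  ∑ⱽ k 2 (λ x → # S (f , x))
    ≤⟨ ∑ⱽ-mono k 2 (λ x → stays-or-leaves (S (f , x)) (σ k 2 (f , x))) ⟩
  ∑ⱽ k 2 (λ x → leaving x + occupied (rank k 2 x))
    ≡⟨ ∑ⱽ-+ k 2 leaving (occupied ∘ rank k 2) ⟩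
  ∑ⱽ k 2 leaving + ∑ⱽ k 2 (occupied ∘ rank k 2)
    -- The vertex of rank u is joined to copy `punchIn f u`, so the vertices of copy f reach every
    -- other copy exactly once.
    ≡⟨ cong (∑ⱽ k 2 leaving +_) (∑ⱽ-rank k 2 occupied) ⟩
  ∑ⱽ k 2 leaving + sum occupied ∎
  where
  open ≤-Reasoning
  leaving = λ x → # (S (f , x) ∧ not (S (σ k 2 (f , x))))
  occupied = λ u → 1 ⊓ size k (λ y → S (punchIn f u , y))
  stays-or-leaves : ∀ p v → # p ≤ # (p ∧ not (S v)) + (1 ⊓ size k (λ y → S (proj₁ v , y)))
  stays-or-leaves false v       = z≤n
  stays-or-leaves true  (i , y) with S (i , y) | term≤∑ⱽ k 2 (λ y → # S (i , y)) y
  ... | true  | 1≤size = ⊓-glb ≤-refl 1≤size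
  ... | false | _      = s≤s z≤n

-- A path on j ≤ 3 vertices has boundary j (k + 1) − 2 (j − 1) in this (k + 1)-regular graph; the
-- bound is that number with j added on both sides, so that no subtraction occurs.
isoperimetry : ∀ k S j → 1 ≤ j → j ≤ 3 → j ≤ size k S → j ≤ size k (not ∘ S) → j * k + 2 ≤ boundary k S + j
-- For k = 0 the left side is 2, so only j = 1 needs a boundary edge.
isoperimetry zero S (suc (suc j)) _ _ _ _ =
  ≤-trans (≤-reflexive (cong (_+ 2) (*-zeroʳ j))) (≤-trans (s≤s (s≤s z≤n)) (m≤n+m (suc (suc j)) _))
isoperimetry zero S 1 _ _ 1≤s 1≤b with S 0F | S 1F
... | true  | true  = contradiction 1≤b λ ()
... | true  | false = ≤-refl
... | false | true  = ≤-refl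
... | false | false = contradiction 1≤s λ ()
isoperimetry (suc k) S j 1≤j j≤3 j≤s j≤b = begin
  -- Cancelling j leaves j k + 2 ≤ |∂S|, which is the form of the bounds in `Copies` with d = k.
  j * suc k + 2         ≡⟨ rearrange j k ⟩
  j * k + 2 + j         ≤⟨ +-monoˡ-≤ j (cases (Fin.any? λ i → bᵢ S i ≟ 0) (Fin.any? λ i → sᵢ S i ≟ 0)) ⟩
  boundary (suc k) S + j ∎
  where
  open ≤-Reasoning
  rearrange : ∀ j k → j * suc k + 2 ≡ j * k + 2 + j
  rearrange = solve-∀
  sᵢ bᵢ : (Vertex (suc k) 2 → Bool) → Fin (suc (t k 2)) → ℕ
  sᵢ S i = size k λ x → S (i , x)
  bᵢ S i = size k λ x → not (S (i , x))
  module C (S : Vertex (suc k) 2 → Bool) = Copies (t-large k) (sᵢ S) (bᵢ S)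
    (λ i → boundary k λ x → S (i , x))
    (λ i → ∑ⱽ k 2 λ x → # (S (i , x) ∧ not (S (σ k 2 (i , x)))))
    (λ i → size+size-not k λ x → S (i , x))
    (out-count k S)
    (λ i → isoperimetry k λ x → S (i , x))
  cases : Dec _ → Dec _ → j * k + 2 ≤ boundary (suc k) S
  cases (no ¬full) _ = C.boundary-no-full S (λ i → n≢0⇒n>0 λ bi≡0 → ¬full (i , bi≡0)) j 1≤j j≤3 j≤s
  -- No copy is empty for S, hence none is full for the complement.
  cases (yes _) (no ¬empty) = ≤-trans
    (C.boundary-no-full (not ∘ S)
      (λ i → ≤-trans (n≢0⇒n>0 λ si≡0 → ¬empty (i , si≡0)) (size-not-not k λ x → S (i , x))) j 1≤j j≤3 j≤b)
    (boundary-not (suc k) S)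
  cases (yes (f , full)) (yes (e , empty)) = ≤-trans
    (≤-trans (+-monoˡ-≤ 2 (*-monoˡ-≤ k j≤3)) (t-large k)) (C.T≤boundary S full empty)

-- From cuts to vertex sets

Adj-sym : ∀ k n {u v} → Adj k n u v → Adj k n v u
Adj-sym zero    n u≢v                        = u≢v ∘ sym
Adj-sym (suc k) n (inj₁ (i≡j , xy))  = inj₁ (sym i≡j , Adj-sym k n xy)
Adj-sym (suc k) n (inj₂ cross)               = inj₂ (Sum.swap cross)

Reach-sym : ∀ {V : Set} {E : V → V → Set} (F : List (V × V)) → (∀ {u v} → E u v → E v u) →
            ∀ {u v} → Reach E F u v → Reach E F v u
Reach-sym F E-sym = reverse λ (uv , ∉F) → E-sym uv , ∉F ∘ Sum.swap

-- Double negation commutes with finite conjunctions, and `unrank` enumerates the vertices.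
¬¬-∀ⱽ : ∀ k n {P : Vertex k n → Set} → (∀ v → ¬ ¬ P v) → ¬ ¬ (∀ v → P v)
¬¬-∀ⱽ k n {P} ¬¬P ¬∀P =
  Fin.sequence (RawMonad.rawApplicative ¬¬-Monad) (λ w → ¬¬P (unrank k n w))
    λ ∀P → ¬∀P λ v → subst P (unrank-rank k n v) (∀P (rank k n v))

count : ∀ {k} → List (Vertex k 2 × Vertex k 2) → Vertex k 2 → Vertex k 2 → ℕ
count []            u v = 0
count ((a , b) ∷ F) u v = ⟦ isPair? a b u v ⟧ + count F u v

∑ᴱ-count : ∀ k F → ∑ᴱ k (count F) ≤ length F
∑ᴱ-count k []            = ≤-reflexive (∑ᴱ-zero k)
∑ᴱ-count k ((a , b) ∷ F) = begin
  ∑ᴱ k (count ((a , b) ∷ F))                            ≡⟨ ∑ᴱ-+ k (λ u v → ⟦ isPair? a b u v ⟧) (count F) ⟩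
  ∑ᴱ k (λ u v → ⟦ isPair? a b u v ⟧) + ∑ᴱ k (count F)   ≤⟨ +-mono-≤ (∑ᴱ-isPair≤1 k a b) (∑ᴱ-count k F) ⟩
  suc (length F)                                        ∎
  where open ≤-Reasoning

∈⇒1≤count : ∀ {k} {u v : Vertex k 2} {F} → (u , v) ∈ F → 1 ≤ count F u v
∈⇒1≤count {u = u} {v} {_ ∷ F} (here refl) =
  ≤-trans (≤-reflexive (sym (⟦⟧-yes (isPair? u v u v) (refl , refl)))) (m≤m+n _ (count F u v))
∈⇒1≤count {u = u} {v} {(a , b) ∷ F} (there uv∈F) = ≤-trans (∈⇒1≤count uv∈F) (m≤n+m _ ⟦ isPair? a b u v ⟧)

-- A cut may list an edge in either direction; pointing it out of S matches the direction counted by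
-- `boundary`.
orient : ∀ {V : Set} → (V → Bool) → V × V → V × V
orient S (a , b) = if S a then (a , b) else (b , a)

orient-∈ : ∀ {V : Set} (S : V → Bool) {F u v} → S u ≡ true → S v ≡ false →
           (u , v) ∈ F ⊎ (v , u) ∈ F → (u , v) ∈ map (orient S) F
orient-∈ S {F} {u} {v} Su Sv (inj₁ uv∈F) =
  subst (_∈ map (orient S) F) (cong (if_then (u , v) else (v , u)) Su) (∈-map⁺ (orient S) uv∈F)
orient-∈ S {F} {u} {v} Su Sv (inj₂ vu∈F) =
  subst (_∈ map (orient S) F) (cong (if_then (v , u) else (u , v)) Sv) (∈-map⁺ (orient S) vu∈F)

boundary≤length : ∀ k S F →
  (∀ {u v} → Adj k 2 u v → S u ≡ true → S v ≡ false → (u , v) ∈ F ⊎ (v , u) ∈ F) →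
  boundary k S ≤ length F
boundary≤length k S F covered = begin
  boundary k S                       ≤⟨ ∑ᴱ-mono k counted ⟩
  ∑ᴱ k (count (map (orient S) F))    ≤⟨ ∑ᴱ-count k (map (orient S) F) ⟩
  length (map (orient S) F)          ≡⟨ length-map (orient S) F ⟩
  length F                           ∎
  where
  open ≤-Reasoning
  counted : ∀ u v → Adj k 2 u v → # (S u ∧ not (S v)) ≤ count (map (orient S) F) u v
  counted u v uv with S u in Su | S v in Sv
  ... | true  | true  = z≤n
  ... | true  | false = ∈⇒1≤count (orient-∈ S Su Sv (covered uv Su Sv))
  ... | false | _     = z≤n

3≤size : ∀ k (S : Vertex k 2 → Bool) {a b c} → a ≢ b → a ≢ c → b ≢ c →
         S a ≡ true → S b ≡ true → S c ≡ true → 3 ≤ size k S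
3≤size k S {a} {b} {c} a≢b a≢c b≢c Sa Sb Sc = begin
  3                                            ≤⟨ +-mono-≤ (+-mono-≤ (1≤∑ a) (1≤∑ b)) (1≤∑ c) ⟩
  (∑ⱽ k 2 [ a ] + ∑ⱽ k 2 [ b ]) + ∑ⱽ k 2 [ c ] ≡⟨ cong (_+ ∑ⱽ k 2 [ c ]) (∑ⱽ-+ k 2 [ a ] [ b ]) ⟨
  ∑ⱽ k 2 (λ v → [ a ] v + [ b ] v) + ∑ⱽ k 2 [ c ] ≡⟨ ∑ⱽ-+ k 2 (λ v → [ a ] v + [ b ] v) [ c ] ⟨
  ∑ⱽ k 2 (λ v → ([ a ] v + [ b ] v) + [ c ] v) ≤⟨ ∑ⱽ-mono k 2 disjoint ⟩
  size k S                                     ∎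
  where
  open ≤-Reasoning
  [_] : Vertex k 2 → Vertex k 2 → ℕ
  [ u ] v = ⟦ v ≟ⱽ u ⟧
  1≤∑ : ∀ u → 1 ≤ ∑ⱽ k 2 [ u ]
  1≤∑ u = ≤-trans (≤-reflexive (sym (⟦⟧-yes (u ≟ⱽ u) refl))) (term≤∑ⱽ k 2 [ u ] u)
  disjoint : ∀ v → ([ a ] v + [ b ] v) + [ c ] v ≤ # S v
  disjoint v with v ≟ⱽ a | v ≟ⱽ b | v ≟ⱽ c
  ... | yes refl | yes refl | _        = contradiction refl a≢b
  ... | yes refl | no _     | yes refl = contradiction refl a≢c
  ... | yes refl | no _     | no _     = ≤-reflexive (cong #_ (sym Sa))
  ... | no _     | yes refl | yes refl = contradiction refl b≢c
  ... | no _     | yes refl | no _     = ≤-reflexive (cong #_ (sym Sb))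
  ... | no _     | no _     | yes refl = ≤-reflexive (cong #_ (sym Sc))
  ... | no _     | no _     | no _     = z≤n

-- Reachability is not decidable by itself, but the bound is stable under double negation.
cut-lower-bound : ∀ k F → Is3RestrictedCut (Adj k 2) F → 3 * k ∸ 1 ≤ length F
cut-lower-bound k F (_ , (x , y , ¬x⇝y) , third) = decidable-stable (3 * k ∸ 1 ≤? length F) λ ¬bound →
  ¬¬-∀ⱽ k 2 (λ v → ¬¬-excluded-middle) (¬bound ∘ bound)
  where
  bound : (∀ v → Dec (Reach (Adj k 2) F x v)) → 3 * k ∸ 1 ≤ length F
  bound reach? = begin
    -- Cancelling 2 in `large` gives 3 k ≤ |∂S| + 1.
    3 * k ∸ 1                ≤⟨ ∸-monoˡ-≤ 1 (+-cancelʳ-≤ 2 (3 * k) (boundary k S + 1) (≤-trans large (≤-reflexive (sym (+-assoc (boundary k S) 1 2))))) ⟩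
    boundary k S + 1 ∸ 1     ≡⟨ m+n∸n≡m (boundary k S) 1 ⟩
    boundary k S             ≤⟨ boundary≤length k S F covered ⟩
    length F                 ∎
    where
    open ≤-Reasoning
    open DecMembership (≡-dec (_≟ⱽ_ {k} {2}) _≟ⱽ_) using (_∈?_)
    S : Vertex k 2 → Bool
    S v = does (reach? v)
    inside : ∀ {v} → Reach (Adj k 2) F x v → S v ≡ true
    inside {v} = dec-true (reach? v)
    outside : ∀ {v} → Reach (Adj k 2) F y v → not (S v) ≡ true
    outside {v} y⇝v = cong not (dec-false (reach? v) λ x⇝v → ¬x⇝y (x⇝v ◅◅ Reach-sym F (Adj-sym k 2) y⇝v))
    covered : ∀ {u v} → Adj k 2 u v → S u ≡ true → S v ≡ false → (u , v) ∈ F ⊎ (v , u) ∈ F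
    covered {u} {v} uv Su Sv with reach? u | reach? v
    -- An edge outside the cut would make v reachable through u. Membership in F is decidable, so
    -- this refutation suffices.
    covered {u} {v} uv Su Sv | yes x⇝u | no ¬x⇝v = decidable-stable ((u , v) ∈? F ⊎-dec (v , u) ∈? F)
      λ ∉F → ¬x⇝v (x⇝u ◅◅ (uv , ∉F) ◅ ε)
    size-S : 3 ≤ size k S
    size-S with a , b , x≢a , x≢b , a≢b , x⇝a , x⇝b ← third x =
      3≤size k S x≢a x≢b a≢b (inside ε) (inside x⇝a) (inside x⇝b)
    size-not-S : 3 ≤ size k (not ∘ S)
    size-not-S with a , b , y≢a , y≢b , a≢b , y⇝a , y⇝b ← third y =
      3≤size k (not ∘ S) y≢a y≢b a≢b (outside ε) (outside y⇝a) (outside y⇝b)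
    large : 3 * k + 2 ≤ boundary k S + 3
    large = isoperimetry k S 3 (s≤s z≤n) ≤-refl size-S size-not-S

-- A cut attaining the bound

Cross? : ∀ k n u v → Dec (Cross k n u v)
Cross? k n (a , x) (b , y) = (toℕ a <? toℕ b) ×-dec (uid k n x ≟ toℕ b ∸ 1) ×-dec (uid k n y ≟ toℕ a)

Adj? : ∀ k n u v → Dec (Adj k n u v)
Adj? zero    n a b = ¬? (a Fin.≟ b)
Adj? (suc k) n (i , x) (j , y) =
  ((i Fin.≟ j) ×-dec Adj? k n x y) ⊎-dec (Cross? k n (i , x) (j , y) ⊎-dec Cross? k n (j , y) (i , x))

-- D₁ is the 6-cycle 00 – 10 – 11 – 21 – 20 – 01 – 00, of which 01 – 00 – 10 is one half, and
-- cut k below is the set of edges leaving that path inside copy 0 … 0 of D₁.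
path : ∀ k → Fin 3 → Vertex (suc k) 2
path zero    0F = 0F , 1F
path zero    1F = 0F , 0F
path zero    2F = 1F , 0F
path (suc k) i  = zero , path k i

origin : ∀ k → Vertex k 2
origin zero    = 0F
origin (suc k) = zero , origin k

uid-origin : ∀ k → uid k 2 (origin k) ≡ 0
uid-origin zero    = refl
uid-origin (suc k) = uid-origin k

-- Copy 0 has the smallest index, so its cross edges end at the vertex of uid 0 in the other copies.
partner : ∀ k → Vertex k 2 → Vertex (suc k) 2
partner k x = suc (rank k 2 x) , origin k

Cross-partner : ∀ k x → Cross k 2 (zero , x) (partner k x)
Cross-partner k x = z<s , uid≡toℕ-rank k 2 x , uid-origin k

partner-unique : ∀ k x {v} → Cross k 2 (zero , x) v → v ≡ partner k x
partner-unique k x {suc b , y} (_ , uid-x , uid-y) = cong₂ (λ b y → suc b , y)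
  (Fin.toℕ-injective (trans (sym uid-x) (uid≡toℕ-rank k 2 x)))
  (uid-injective k 2 (trans uid-y (sym (uid-origin k))))

Edge : ℕ → Set
Edge k = Vertex k 2 × Vertex k 2

inCopy₀ : ∀ {k} → Edge k → Edge (suc k)
inCopy₀ (a , b) = (zero , a) , (zero , b)

crossCut : ∀ k → Fin 3 → Edge (suc (suc k))
crossCut k i = (zero , path k i) , partner (suc k) (path k i)

cut : ∀ k → List (Edge (suc k))
cut zero    = ((0F , 1F) , (2F , 0F)) ∷ ((1F , 0F) , (1F , 1F)) ∷ []
cut (suc k) = map inCopy₀ (cut k) ++ tabulate (crossCut k)

length-cut : ∀ k → length (cut k) ≡ 3 * k + 2
length-cut zero    = refl
length-cut (suc k) = begin
  length (cut (suc k))                    ≡⟨ length-++ (map inCopy₀ (cut k)) ⟩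
  length (map inCopy₀ (cut k)) + 3        ≡⟨ cong (_+ 3) (trans (length-map inCopy₀ (cut k)) (length-cut k)) ⟩
  3 * k + 2 + 3                           ≡⟨ rearrange k ⟩
  3 * suc k + 2                           ∎
  where
  open ≡-Reasoning
  rearrange : ∀ k → 3 * k + 2 + 3 ≡ 3 * suc k + 2
  rearrange = solve-∀

cut-edges : ∀ k → All (λ e → Adj (suc k) 2 (proj₁ e) (proj₂ e)) (cut k)
cut-edges zero    = inj₂ (inj₁ (z<s , refl , refl)) ∷ inj₁ (refl , λ ()) ∷ []
cut-edges (suc k) = All.++⁺
  (All.map⁺ (All.map (λ uv → inj₁ (refl , uv)) (cut-edges k)))
  (All.tabulate⁺ {f = crossCut k} λ i → inj₂ (inj₁ (Cross-partner (suc k) (path k i))))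

path-injective : ∀ k {i j} → path k i ≡ path k j → i ≡ j
path-injective zero {i} {j} = from-yes (Fin.all? λ i → Fin.all? λ j →
  (path 0 i ≟ⱽ path 0 j) →-dec (i Fin.≟ j)) i j
path-injective (suc k) eq = path-injective k (cong proj₂ eq)

cut-distinct : ∀ k → AllPairs (λ e f → ¬ SameEdge e f) (cut k)
cut-distinct zero    = ((λ { (inj₁ ()) ; (inj₂ ()) }) ∷ []) ∷ [] ∷ []
cut-distinct (suc k) = AllPairs.++⁺
  (AllPairs.map⁺ (AllPairs.map
    (λ e≁f → e≁f ∘ Sum.map (λ (p , q) → cong proj₂ p , cong proj₂ q) (λ (p , q) → cong proj₂ p , cong proj₂ q))
    (cut-distinct k)))
  (AllPairs.tabulate⁺ {f = crossCut k} λ i≢j → λ where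
    (inj₁ (p , _)) → i≢j (path-injective k (cong proj₂ p))
    (inj₂ (() , _)))
  -- An edge inside copy 0 is no cross edge, since the latter ends in a copy of positive index.
  (All.map⁺ (All.universal (λ e → All.tabulate⁺ {f = crossCut k} λ i → λ { (inj₁ (_ , ())) ; (inj₂ (() , _)) }) (cut k)))

-- For D₁ this is a finite check. Above that, an edge from the path stays in copy 0, where induction
-- applies, or is the only cross edge of its vertex, which is cut.
path-closed : ∀ k i v → AdjMinus (Adj (suc k) 2) (cut k) (path k i) v → ∃[ j ] v ≡ path k j
path-closed zero i (a , x) (uv , ∉F) with from-yes (Fin.all? λ i → Fin.all? λ a → Fin.all? λ x →
  Adj? 1 2 (path 0 i) (a , x) →-dec
  (Fin.any? (λ j → (a , x) ≟ⱽ path 0 j) ⊎-dec (path 0 i , (a , x)) ∈? cut 0)) i a x uv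
  where open DecMembership (≡-dec (_≟ⱽ_ {1} {2}) (_≟ⱽ_ {1} {2})) using (_∈?_)
... | inj₁ ∈path = ∈path
... | inj₂ ∈F    = contradiction (inj₁ ∈F) ∉F
path-closed (suc k) i (zero , x) (inj₁ (refl , uv) , ∉F)
  with j , refl ← path-closed k i x (uv , ∉F ∘ Sum.map (∈-++⁺ˡ ∘ ∈-map⁺ inCopy₀) (∈-++⁺ˡ ∘ ∈-map⁺ inCopy₀))
  = j , refl
path-closed (suc k) i v (inj₂ (inj₁ cross) , ∉F)
  with refl ← partner-unique (suc k) (path k i) {v} cross
  = contradiction (inj₁ (∈-++⁺ʳ (map inCopy₀ (cut k)) (∈-tabulate⁺ {f = crossCut k} i))) ∉F

Reach-path : ∀ k i {v} → Reach (Adj (suc k) 2) (cut k) (path k i) v → ∃[ j ] v ≡ path k j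
Reach-path k i ε = i , refl
Reach-path k i (_◅_ {j = u} uv rest) with j , refl ← path-closed k i u uv = Reach-path k j rest

far : ∀ k → Vertex (suc k) 2
far zero    = 2F , 1F
far (suc k) = zero , far k

far≢path : ∀ k i → far k ≢ path k i
far≢path zero    0F ()
far≢path zero    1F ()
far≢path zero    2F ()
far≢path (suc k) i  eq = far≢path k i (cong proj₂ eq)

-- Within a copy only images of `cut k` can be missing, and these only in copy 0. Hence walks that
-- avoid `cut k` lift to every copy.
∈-cut-copy : ∀ k {i x y} → ((i , x) , (i , y)) ∈ cut (suc k) → (x , y) ∈ cut k
∈-cut-copy k ∈F with ∈-++⁻ (map inCopy₀ (cut k)) ∈F
... | inj₁ ∈map with _ , ∈F′ , refl ← ∈-map⁻ inCopy₀ ∈map = ∈F′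
... | inj₂ ∈tab with _ , () ← ∈-tabulate⁻ {f = crossCut k} ∈tab

Reach-copy : ∀ k i {x y} → Reach (Adj (suc k) 2) (cut k) x y → Reach (Adj (suc (suc k)) 2) (cut (suc k)) (i , x) (i , y)
Reach-copy k i = gmap (i ,_) λ (xy , ∉F) → inj₁ (refl , xy) , ∉F ∘ Sum.map (∈-cut-copy k) (∈-cut-copy k)

component≥3 : ∀ k (x : Vertex (suc k) 2) → ∃[ y ] ∃[ z ]
  (x ≢ y × x ≢ z × y ≢ z × Reach (Adj (suc k) 2) (cut k) x y × Reach (Adj (suc k) 2) (cut k) x z)
component≥3 (suc k) (i , x) with y , z , x≢y , x≢z , y≢z , x⇝y , x⇝z ← component≥3 k x =
  (i , y) , (i , z) , x≢y ∘ cong proj₂ , x≢z ∘ cong proj₂ , y≢z ∘ cong proj₂ ,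
  Reach-copy k i x⇝y , Reach-copy k i x⇝z
component≥3 zero = λ where
    -- The 6-cycle falls into 01 - 00 - 10 and 11 - 21 - 20; `end` starts from an end of such a path
    -- and `mid` from its middle.
    (0F , 1F) → end (0F , 1F) (0F , 0F) (1F , 0F) (λ ()) (λ ()) (λ ())
    (0F , 0F) → mid (0F , 1F) (0F , 0F) (1F , 0F) (λ ()) (λ ()) (λ ())
    (1F , 0F) → end (1F , 0F) (0F , 0F) (0F , 1F) (λ ()) (λ ()) (λ ())
    (1F , 1F) → end (1F , 1F) (2F , 1F) (2F , 0F) (λ ()) (λ ()) (λ ())
    (2F , 1F) → mid (1F , 1F) (2F , 1F) (2F , 0F) (λ ()) (λ ()) (λ ())
    (2F , 0F) → end (2F , 0F) (2F , 1F) (1F , 1F) (λ ()) (λ ()) (λ ())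
  where
  open DecMembership (≡-dec (_≟ⱽ_ {1} {2}) (_≟ⱽ_ {1} {2})) using (_∈?_)
  R = Reach (Adj 1 2) (cut 0)
  Step? : ∀ u v → Dec (AdjMinus (Adj 1 2) (cut 0) u v)
  Step? u v = Adj? 1 2 u v ×-dec ¬? ((u , v) ∈? cut 0 ⊎-dec (v , u) ∈? cut 0)
  end : ∀ a b c {ab : True (Step? a b)} {bc : True (Step? b c)} → a ≢ b → a ≢ c → b ≢ c →
        ∃[ y ] ∃[ z ] (a ≢ y × a ≢ z × y ≢ z × R a y × R a z)
  end a b c {ab} {bc} a≢b a≢c b≢c =
    b , c , a≢b , a≢c , b≢c , toWitness ab ◅ ε , toWitness ab ◅ toWitness bc ◅ ε
  mid : ∀ a b c {ba : True (Step? b a)} {bc : True (Step? b c)} → b ≢ a → b ≢ c → a ≢ c →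
        ∃[ y ] ∃[ z ] (b ≢ y × b ≢ z × y ≢ z × R b y × R b z)
  mid a b c {ba} {bc} b≢a b≢c a≢c = a , c , b≢a , b≢c , a≢c , toWitness ba ◅ ε , toWitness bc ◅ ε

cut-is-3-restricted : ∀ k → Is3RestrictedCut (Adj (suc k) 2) (cut k)
cut-is-3-restricted k =
  (cut-edges k , cut-distinct k) ,
  (path k 0F , far k , λ reach → let j , eq = Reach-path k 0F reach in far≢path k j eq) ,
  component≥3 k

theorem12 : (k : ℕ) → 2 ≤ k → Lambda3≡ (Adj k 2) (3 * k ∸ 1)
theorem12 (suc k) _ = (cut k , cut-is-3-restricted k , trans (length-cut k) (rearrange k)) , cut-lower-bound (suc k)
  where
  -- The right side is what `3 * suc k ∸ 1` computes to.
  rearrange : ∀ k → 3 * k + 2 ≡ k + (suc k + (suc k + 0))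
  rearrange = solve-∀
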